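{- Let $\kappa$ be an infinite cardinal. If a Boolean algebra supports a uniformly $\kappa$-regular (non-atomic) measure, then it is isomorphic to a subalgebra of the $\sigma$-completion of a quotient of $\mathrm{Free}(\kappa)$.
   Context: A measure on a Boolean algebra is a finitely additive non-negative finite function, normalized to have value $1$ at the unit. An algebra supports $\mu$ if $\mu$ is defined on all of it and strictly positive; $\mu$ is non-atomic if for every $\varepsilon>0$ there is a finite partition of unity into elements of measure at most $\varepsilon$. A family $\mathcal{F}\subseteq\mathfrak{B}$ is uniformly $\mu$-dense if for every $b\in\mathfrak{B}$ and $\varepsilon>0$ there is $a\in\mathcal{F}$ with $a\le b$ and $\mu(b\setminus a)<\varepsilon$; $\mathrm{ur}(\mu)$ is the least cardinality of a uniformly $\mu$-dense family. For $b\ne\mathbf{0}$, $\mu\,|\,b$ is the restriction of $\mu$ to $\{c\in\mathfrak{B}:c\le b\}$. An element $a$ is uniform if $\mathrm{ur}(\mu\,|\,b)=\mathrm{ur}(\mu\,|\,a)$ for every $\mathbf{0}\ne b\le a$. $\mu$ is uniformly $\kappa$-regular if $\mathbf{1}$ is a uniform element and $\mathrm{ur}(\mu)=\kappa$. $\mathrm{Free}(\kappa)$ is the free Boolean algebra on $\kappa$ generators. The $\sigma$-completion of a Boolean algebra is the smallest $\sigma$-complete subalgebra (closed under countable joins) of its completion containing it. Isomorphisms and subalgebras are only with respect to finitary Boolean operations. -}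

module Defs where

open import Level using (_⊔_; suc; 0ℓ)
open import Algebra.Lattice.Bundles using (BooleanAlgebra)
open import Algebra.Lattice.Morphism.Structures using (module LatticeMorphisms)
open import Algebra.Lattice.Structures.Biased using (isBooleanAlgebraʳ; isDistributiveLatticeʳʲᵐ)
import Algebra.Lattice.Properties.BooleanAlgebra as BooleanAlgebraProperties
open import Data.Empty using (⊥-elim)
open import Data.Fin.Base using (Fin)
open import Data.Nat.Base using (ℕ)
open import Data.Product.Base using (Σ; ∃; _×_; _,_; proj₁; proj₂)
open import Data.Rational.Base using (ℚ; 0ℚ; 1ℚ) renaming (_<_ to _<ℚ_; _+_ to _+ℚ_; _-_ to _-ℚ_)
import Data.Rational.Properties as ℚ
open import Data.Vec.Functional using (foldr)
open import Function.Base using (_∘_)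
open import Function.Bundles using (Injection; Inverse)
open import Relation.Binary.Bundles using (Setoid; Poset)
open import Relation.Binary.Core using (Rel)
open import Relation.Binary.Structures using (IsEquivalence)
import Relation.Binary.Construct.On as On
open import Relation.Binary.Definitions using (tri<; tri≈; tri>)
import Relation.Binary.PropositionalEquality as ≡
open ≡ using (_≡_; _≢_)
open import Relation.Nullary.Negation using (¬_)
open import Relation.Unary using (Pred; _∈_; _∉_; _⊆_)

-- A real number is the set of rationals below it (a one-sided Dedekind cut).
record ℝ : Set₁ where
  field
    Cut       : Pred ℚ 0ℓ
    inhabited : ∃ λ p → p ∈ Cut
    proper    : ∃ λ p → p ∉ Cut
    downward  : ∀ {p q} → p <ℚ q → q ∈ Cut → p ∈ Cut
    open-cut  : ∀ {p} → p ∈ Cut → ∃ λ q → p <ℚ q × q ∈ Cut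

open ℝ

infix 4 _≃_ _≤ʳ_ _<ʳ_
infixl 6 _+ʳ_

_≤ʳ_ : Rel ℝ 0ℓ
x ≤ʳ y = Cut x ⊆ Cut y

_≃_ : Rel ℝ 0ℓ
x ≃ y = x ≤ʳ y × y ≤ʳ x

-- Cuts are linearly ordered by inclusion, so a rational in the second cut
-- but not in the first makes the inclusion of the first one proper.
_<ʳ_ : Rel ℝ 0ℓ
x <ʳ y = ∃ λ q → q ∈ Cut y × q ∉ Cut x

fromℚ : ℚ → ℝ
fromℚ r = record
  { Cut       = _<ℚ r
  ; inhabited = r -ℚ 1ℚ , ≡.subst (r -ℚ 1ℚ <ℚ_) (ℚ.+-identityʳ r) (ℚ.+-monoʳ-< r (ℚ.neg-antimono-< (ℚ.positive⁻¹ 1ℚ)))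
  ; proper    = r , ℚ.<-irrefl ≡.refl
  ; downward  = ℚ.<-trans
  ; open-cut  = ℚ.<-dense
  }

0ʳ 1ʳ : ℝ
0ʳ = fromℚ 0ℚ
1ʳ = fromℚ 1ℚ

private
  ∉⇒∈< : ∀ x {b p} → b ∉ Cut x → p ∈ Cut x → p <ℚ b
  ∉⇒∈< x {b} {p} b∉x p∈x with ℚ.<-cmp p b
  ... | tri< p<b _ _ = p<b
  ... | tri≈ _ ≡.refl _ = ⊥-elim (b∉x p∈x)
  ... | tri> _ _ b<p = ⊥-elim (b∉x (downward x b<p p∈x))

  -+-cancel : ∀ r q → (r -ℚ q) +ℚ q ≡ r
  -+-cancel r q = ≡.trans (ℚ.+-assoc r _ q)
    (≡.trans (≡.cong (r +ℚ_) (ℚ.+-inverseˡ q)) (ℚ.+-identityʳ r))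

  +--cancel : ∀ p q → (p +ℚ q) -ℚ q ≡ p
  +--cancel p q = ≡.trans (ℚ.+-assoc p q _)
    (≡.trans (≡.cong (p +ℚ_) (ℚ.+-inverseʳ q)) (ℚ.+-identityʳ p))

_+ʳ_ : ℝ → ℝ → ℝ
x +ʳ y = record
  { Cut       = λ r → ∃ λ p → ∃ λ q → p ∈ Cut x × q ∈ Cut y × r ≡ p +ℚ q
  ; inhabited = let (p , p∈x) = inhabited x ; (q , q∈y) = inhabited y in
                p +ℚ q , p , q , p∈x , q∈y , ≡.refl
  ; proper    = let (a , a∉x) = proper x ; (b , b∉y) = proper y in
                a +ℚ b , λ (p , q , p∈x , q∈y , a+b≡p+q) →
                  ℚ.<-irrefl (≡.sym a+b≡p+q) (ℚ.+-mono-< (∉⇒∈< x a∉x p∈x) (∉⇒∈< y b∉y q∈y))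
  ; downward  = λ { {r} r<s (p , q , p∈x , q∈y , ≡.refl) →
                  r -ℚ q , q
                  , downward x (≡.subst (r -ℚ q <ℚ_) (+--cancel p q) (ℚ.+-monoˡ-< _ r<s)) p∈x
                  , q∈y , ≡.sym (-+-cancel r q) }
  ; open-cut  = λ { (p , q , p∈x , q∈y , ≡.refl) →
                  let (p⁺ , p<p⁺ , p⁺∈x) = open-cut x p∈x in
                  p⁺ +ℚ q , ℚ.+-monoˡ-< q p<p⁺ , p⁺ , q , p⁺∈x , q∈y , ≡.refl }
  }

-- Sets are setoids.  A cardinal is represented by any set of that
-- cardinality: κ ≤ λ means that κ injects into λ, and κ = λ means that
-- there are mutually inverse maps between κ and λ.

Infinite : ∀ {c ℓ} → Setoid c ℓ → Set (c ⊔ ℓ)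
Infinite κ = ∀ n → ¬ Inverse κ (≡.setoid (Fin n))

subset : ∀ {c ℓ p} (S : Setoid c ℓ) → Pred (Setoid.Carrier S) p → Setoid (c ⊔ p) ℓ
subset S P = On.setoid {B = Σ (Setoid.Carrier S) P} S proj₁

module Order {c ℓ} (A : BooleanAlgebra c ℓ) where
  open BooleanAlgebra A renaming (¬_ to ∁)

  -- x ≤ y unfolds to x ≈ x ∧ y.
  open Poset (BooleanAlgebraProperties.poset A) public using (_≤_)

  infixl 7 _∖_

  _∖_ : Carrier → Carrier → Carrier
  x ∖ y = x ∧ ∁ y

  record IsSupremum {i} {I : Set i} (f : I → Carrier) (s : Carrier) : Set (c ⊔ ℓ ⊔ i) where
    field
      upper : ∀ i → f i ≤ s
      least : ∀ u → (∀ i → f i ≤ u) → s ≤ u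

module _ {a b ℓ₁ ℓ₂} (A : BooleanAlgebra a ℓ₁) (B : BooleanAlgebra b ℓ₂) where
  private
    module A = BooleanAlgebra A
    module B = BooleanAlgebra B
  open LatticeMorphisms A.rawLattice B.rawLattice

  record PreservesComplements (f : A.Carrier → B.Carrier) : Set (a ⊔ ℓ₂) where
    field
      ⊤-homo : f A.⊤ B.≈ B.⊤
      ⊥-homo : f A.⊥ B.≈ B.⊥
      ¬-homo : ∀ x → f (A.¬ x) B.≈ B.¬ f x

  record IsEmbedding (f : A.Carrier → B.Carrier) : Set (a ⊔ ℓ₁ ⊔ ℓ₂) where
    field
      isLatticeMonomorphism : IsLatticeMonomorphism f
      preservesComplements  : PreservesComplements f
    open IsLatticeMonomorphism isLatticeMonomorphism public
    open PreservesComplements preservesComplements public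

  record Isomorphism : Set (a ⊔ b ⊔ ℓ₁ ⊔ ℓ₂) where
    field
      to                   : A.Carrier → B.Carrier
      isLatticeIsomorphism : IsLatticeIsomorphism to
      preservesComplements : PreservesComplements to
    open IsLatticeIsomorphism isLatticeIsomorphism public
    open PreservesComplements preservesComplements public

module _ {a ℓ} (A : BooleanAlgebra a ℓ) where
  open BooleanAlgebra A renaming (¬_ to ∁)
  open BooleanAlgebraProperties A using (∧-identityˡ; ∧-identityʳ; ∧-zeroˡ)
  open Order A

  record Subalgebra p : Set (a ⊔ ℓ ⊔ suc p) where
    field
      Member    : Pred Carrier p
      ∨-closed  : ∀ {x y} → x ∈ Member → y ∈ Member → x ∨ y ∈ Member
      ∧-closed  : ∀ {x y} → x ∈ Member → y ∈ Member → x ∧ y ∈ Member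
      ¬-closed  : ∀ {x} → x ∈ Member → ∁ x ∈ Member
      ⊤-closed  : ⊤ ∈ Member
      ⊥-closed  : ⊥ ∈ Member
      ≈-closed  : ∀ {x y} → x ≈ y → x ∈ Member → y ∈ Member

  subalgebra : ∀ {p} → Subalgebra p → BooleanAlgebra (a ⊔ p) ℓ
  subalgebra S = record
    { Carrier = Σ Carrier Member
    ; _≈_     = λ x y → proj₁ x ≈ proj₁ y
    ; _∨_     = λ (x , x∈S) (y , y∈S) → x ∨ y , ∨-closed x∈S y∈S
    ; _∧_     = λ (x , x∈S) (y , y∈S) → x ∧ y , ∧-closed x∈S y∈S
    ; ¬_      = λ (x , x∈S) → ∁ x , ¬-closed x∈S
    ; ⊤       = ⊤ , ⊤-closed
    ; ⊥       = ⊥ , ⊥-closed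
    ; isBooleanAlgebra = record
      { isDistributiveLattice = record
        { isLattice = record
          { isEquivalence = On.isEquivalence proj₁ isEquivalence
          ; ∨-comm     = λ _ _ → ∨-comm _ _
          ; ∨-assoc    = λ _ _ _ → ∨-assoc _ _ _
          ; ∨-cong     = ∨-cong
          ; ∧-comm     = λ _ _ → ∧-comm _ _
          ; ∧-assoc    = λ _ _ _ → ∧-assoc _ _ _
          ; ∧-cong     = ∧-cong
          ; absorptive = (λ _ _ → ∨-absorbs-∧ _ _) , (λ _ _ → ∧-absorbs-∨ _ _)
          }
        ; ∨-distrib-∧ = (λ _ _ _ → ∨-distribˡ-∧ _ _ _) , (λ _ _ _ → ∨-distribʳ-∧ _ _ _)
        ; ∧-distrib-∨ = (λ _ _ _ → ∧-distribˡ-∨ _ _ _) , (λ _ _ _ → ∧-distribʳ-∨ _ _ _)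
        }
      ; ∨-complement = (λ _ → ∨-complementˡ _) , (λ _ → ∨-complementʳ _)
      ; ∧-complement = (λ _ → ∧-complementˡ _) , (λ _ → ∧-complementʳ _)
      ; ¬-cong       = ¬-cong
      }
    }
    where open Subalgebra S

  -- The algebra {x : x ≤ b}, with unit b and complement b ∖ x.
  infixl 7 _↾_

  _↾_ : Carrier → BooleanAlgebra (a ⊔ ℓ) ℓ
  _↾_ b = record
    { Carrier = Σ Carrier (_≤ b)
    ; _≈_     = λ x y → proj₁ x ≈ proj₁ y
    ; _∨_     = λ (x , x≤b) (y , y≤b) → x ∨ y , trans (∨-cong x≤b y≤b) (sym (∧-distribʳ-∨ b x y))
    ; _∧_     = λ (x , x≤b) (y , y≤b) → x ∧ y , trans (∧-congˡ y≤b) (sym (∧-assoc x y b))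
    ; ¬_      = λ (x , x≤b) → b ∖ x , sym (∖-≤ x)
    ; ⊤       = b , sym (BooleanAlgebraProperties.∧-idem A b)
    ; ⊥       = ⊥ , sym (∧-zeroˡ b)
    ; isBooleanAlgebra = isBooleanAlgebraʳ (record
      { isDistributiveLattice = record
        { isLattice = record
          { isEquivalence = On.isEquivalence proj₁ isEquivalence
          ; ∨-comm     = λ _ _ → ∨-comm _ _
          ; ∨-assoc    = λ _ _ _ → ∨-assoc _ _ _
          ; ∨-cong     = ∨-cong
          ; ∧-comm     = λ _ _ → ∧-comm _ _
          ; ∧-assoc    = λ _ _ _ → ∧-assoc _ _ _
          ; ∧-cong     = ∧-cong
          ; absorptive = (λ _ _ → ∨-absorbs-∧ _ _) , (λ _ _ → ∧-absorbs-∨ _ _)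
          }
        ; ∨-distrib-∧ = (λ _ _ _ → ∨-distribˡ-∧ _ _ _) , (λ _ _ _ → ∨-distribʳ-∧ _ _ _)
        ; ∧-distrib-∨ = (λ _ _ _ → ∧-distribˡ-∨ _ _ _) , (λ _ _ _ → ∧-distribʳ-∨ _ _ _)
        }
      ; ∨-complementʳ = λ (x , x≤b) →
          trans (∨-congʳ (trans x≤b (∧-comm x b)))
          (trans (sym (∧-distribˡ-∨ b x (∁ x)))
          (trans (∧-congˡ (∨-complementʳ x)) (∧-identityʳ b)))
      ; ∧-complementʳ = λ (x , _) →
          trans (∧-congˡ (∧-comm b (∁ x)))
          (trans (sym (∧-assoc x (∁ x) b))
          (trans (∧-congʳ (∧-complementʳ x)) (∧-zeroˡ b)))
      ; ¬-cong = λ x≈y → ∧-congˡ (¬-cong x≈y)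
      })
    }
    where
    ∖-≤ : ∀ x → (b ∖ x) ∧ b ≈ b ∖ x
    ∖-≤ x = trans (∧-comm (b ∖ x) b)
      (trans (sym (∧-assoc b b (∁ x))) (∧-congʳ (BooleanAlgebraProperties.∧-idem A b)))

  record Congruence r : Set (a ⊔ ℓ ⊔ suc r) where
    infix 4 _∼_
    field
      _∼_             : Rel Carrier r
      isEquivalence-∼ : IsEquivalence _∼_
      ≈⇒∼             : ∀ {x y} → x ≈ y → x ∼ y
      ∨-cong-∼        : ∀ {x y u v} → x ∼ y → u ∼ v → x ∨ u ∼ y ∨ v
      ∧-cong-∼        : ∀ {x y u v} → x ∼ y → u ∼ v → x ∧ u ∼ y ∧ v
      ¬-cong-∼        : ∀ {x y} → x ∼ y → ∁ x ∼ ∁ y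

  quotient : ∀ {r} → Congruence r → BooleanAlgebra a r
  quotient θ = record
    { Carrier = Carrier
    ; _≈_     = _∼_
    ; _∨_     = _∨_
    ; _∧_     = _∧_
    ; ¬_      = ∁
    ; ⊤       = ⊤
    ; ⊥       = ⊥
    ; isBooleanAlgebra = record
      { isDistributiveLattice = record
        { isLattice = record
          { isEquivalence = isEquivalence-∼
          ; ∨-comm     = λ x y → ≈⇒∼ (∨-comm x y)
          ; ∨-assoc    = λ x y z → ≈⇒∼ (∨-assoc x y z)
          ; ∨-cong     = ∨-cong-∼
          ; ∧-comm     = λ x y → ≈⇒∼ (∧-comm x y)
          ; ∧-assoc    = λ x y z → ≈⇒∼ (∧-assoc x y z)
          ; ∧-cong     = ∧-cong-∼
          ; absorptive = (λ x y → ≈⇒∼ (∨-absorbs-∧ x y)) , (λ x y → ≈⇒∼ (∧-absorbs-∨ x y))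
          }
        ; ∨-distrib-∧ = (λ x y z → ≈⇒∼ (∨-distribˡ-∧ x y z)) , (λ x y z → ≈⇒∼ (∨-distribʳ-∧ x y z))
        ; ∧-distrib-∨ = (λ x y z → ≈⇒∼ (∧-distribˡ-∨ x y z)) , (λ x y z → ≈⇒∼ (∧-distribʳ-∨ x y z))
        }
      ; ∨-complement = (λ x → ≈⇒∼ (∨-complementˡ x)) , (λ x → ≈⇒∼ (∨-complementʳ x))
      ; ∧-complement = (λ x → ≈⇒∼ (∧-complementˡ x)) , (λ x → ≈⇒∼ (∧-complementʳ x))
      ; ¬-cong       = ¬-cong-∼
      }
    }
    where open Congruence θ

-- Boolean terms in the generators, modulo provable equality.
module FreeBooleanAlgebra {c ℓ} (κ : Setoid c ℓ) where
  open Setoid κ using () renaming (Carrier to Generator; _≈_ to _≈ᵍ_)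

  infix  8 ∁_
  infixr 7 _∧_
  infixr 6 _∨_
  infix  4 _≈_

  data Term : Set c where
    gen     : Generator → Term
    _∨_ _∧_ : Term → Term → Term
    ∁_      : Term → Term
    ⊤ ⊥     : Term

  data _≈_ : Rel Term (c ⊔ ℓ) where
    refl          : ∀ {x} → x ≈ x
    sym           : ∀ {x y} → x ≈ y → y ≈ x
    trans         : ∀ {x y z} → x ≈ y → y ≈ z → x ≈ z
    gen-cong      : ∀ {i j} → i ≈ᵍ j → gen i ≈ gen j
    ∨-cong        : ∀ {x y u v} → x ≈ y → u ≈ v → x ∨ u ≈ y ∨ v
    ∧-cong        : ∀ {x y u v} → x ≈ y → u ≈ v → x ∧ u ≈ y ∧ v
    ∁-cong        : ∀ {x y} → x ≈ y → ∁ x ≈ ∁ y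
    ∨-comm        : ∀ x y → x ∨ y ≈ y ∨ x
    ∨-assoc       : ∀ x y z → (x ∨ y) ∨ z ≈ x ∨ (y ∨ z)
    ∧-comm        : ∀ x y → x ∧ y ≈ y ∧ x
    ∧-assoc       : ∀ x y z → (x ∧ y) ∧ z ≈ x ∧ (y ∧ z)
    ∨-absorbs-∧   : ∀ x y → x ∨ (x ∧ y) ≈ x
    ∧-absorbs-∨   : ∀ x y → x ∧ (x ∨ y) ≈ x
    ∨-distribʳ-∧  : ∀ x y z → (y ∧ z) ∨ x ≈ (y ∨ x) ∧ (z ∨ x)
    ∨-complementʳ : ∀ x → x ∨ ∁ x ≈ ⊤
    ∧-complementʳ : ∀ x → x ∧ ∁ x ≈ ⊥

Free : ∀ {c ℓ} → Setoid c ℓ → BooleanAlgebra c (c ⊔ ℓ)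
Free κ = record
  { Carrier = Term
  ; _≈_     = _≈_
  ; _∨_     = _∨_
  ; _∧_     = _∧_
  ; ¬_      = ∁_
  ; ⊤       = ⊤
  ; ⊥       = ⊥
  ; isBooleanAlgebra = isBooleanAlgebraʳ (record
    { isDistributiveLattice = isDistributiveLatticeʳʲᵐ (record
      { isLattice = record
        { isEquivalence = record { refl = refl ; sym = sym ; trans = trans }
        ; ∨-comm     = ∨-comm
        ; ∨-assoc    = ∨-assoc
        ; ∨-cong     = ∨-cong
        ; ∧-comm     = ∧-comm
        ; ∧-assoc    = ∧-assoc
        ; ∧-cong     = ∧-cong
        ; absorptive = ∨-absorbs-∧ , ∧-absorbs-∨
        }
      ; ∨-distribʳ-∧ = ∨-distribʳ-∧
      })
    ; ∨-complementʳ = ∨-complementʳ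
    ; ∧-complementʳ = ∧-complementʳ
    ; ¬-cong        = ∁-cong
    })
  }
  where open FreeBooleanAlgebra κ

-- A complete Boolean algebra containing A as a dense subalgebra.  As A is a
-- small set (in Set ℓ), the elements of a completion, which amount to
-- subsets of A, form a type in Set (suc ℓ), and completeness means that
-- every family indexed by a set has a supremum.
record Completion {ℓ} (A : BooleanAlgebra ℓ ℓ) : Set (suc (suc ℓ)) where
  field
    algebra : BooleanAlgebra (suc ℓ) ℓ
  private module A = BooleanAlgebra A
  open BooleanAlgebra algebra
  open Order algebra
  field
    complete    : {I : Set ℓ} (f : I → Carrier) → ∃ λ s → IsSupremum f s
    embed       : A.Carrier → Carrier
    isEmbedding : IsEmbedding A algebra embed
    -- Density (every c ≉ ⊥ has an a ≉ ⊥ of A below it), contraposed so as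
    -- not to depend on excluded middle.
    dense       : ∀ c → (∀ a → embed a ≤ c → a A.≈ A.⊥) → c ≈ ⊥

module _ {ℓ} {A : BooleanAlgebra ℓ ℓ} (C : Completion A) where
  open Completion C
  open BooleanAlgebra algebra renaming (¬_ to ∁)
  open Order algebra
  private module embed = IsEmbedding isEmbedding

  -- The smallest subalgebra of the completion that contains A and is closed
  -- under countable joins, generated inductively.
  data σGenerated : Pred Carrier (suc ℓ) where
    embedded : ∀ a → σGenerated (embed a)
    ∨-closed : ∀ {x y} → σGenerated x → σGenerated y → σGenerated (x ∨ y)
    ∧-closed : ∀ {x y} → σGenerated x → σGenerated y → σGenerated (x ∧ y)
    ¬-closed : ∀ {x} → σGenerated x → σGenerated (∁ x)
    ⋁-closed : ∀ (f : ℕ → Carrier) {s} → (∀ n → σGenerated (f n)) →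
               IsSupremum f s → σGenerated s
    ≈-closed : ∀ {x y} → x ≈ y → σGenerated x → σGenerated y

  σCompletion : BooleanAlgebra (suc ℓ) ℓ
  σCompletion = subalgebra algebra (record
    { Member   = σGenerated
    ; ∨-closed = ∨-closed
    ; ∧-closed = ∧-closed
    ; ¬-closed = ¬-closed
    ; ⊤-closed = ≈-closed embed.⊤-homo (embedded _)
    ; ⊥-closed = ≈-closed embed.⊥-homo (embedded _)
    ; ≈-closed = ≈-closed
    })

module _ {ℓ} (B : BooleanAlgebra ℓ ℓ) where
  open BooleanAlgebra B renaming (¬_ to ∁)
  open Order B

  record Measure : Set (suc 0ℓ ⊔ ℓ) where
    field
      μ           : Carrier → ℝ
      μ-cong      : ∀ {x y} → x ≈ y → μ x ≃ μ y
      nonNegative : ∀ x → 0ʳ ≤ʳ μ x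
      additive    : ∀ x y → x ∧ y ≈ ⊥ → μ (x ∨ y) ≃ μ x +ʳ μ y
      normalized  : μ ⊤ ≃ 1ʳ

  -- The following notions are defined for arbitrary functions, so as to
  -- apply to the restrictions of measures, which are not normalized.

  IsUniformlyDense : (Carrier → ℝ) → Pred Carrier ℓ → Set (suc 0ℓ ⊔ ℓ)
  IsUniformlyDense μ F = ∀ b ε → 0ʳ <ʳ ε → ∃ λ a → a ∈ F × a ≤ b × μ (b ∖ a) <ʳ ε

  -- ur(μ) = κ, as a relation: cardinals of setoids are not canonically chosen,
  -- and the existence of a least one is a classical principle.
  record HasUr (μ : Carrier → ℝ) (κ : Setoid ℓ ℓ) : Set (suc (suc 0ℓ ⊔ ℓ)) where
    field
      attained : ∃ λ (F : Pred Carrier ℓ) → IsUniformlyDense μ F × Inverse κ (subset setoid F)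
      minimal  : ∀ (F : Pred Carrier ℓ) → IsUniformlyDense μ F → Injection κ (subset setoid F)

module _ {ℓ} {B : BooleanAlgebra ℓ ℓ} (M : Measure B) where
  open BooleanAlgebra B renaming (¬_ to ∁)
  open Order B
  open Measure M

  -- μ(b) > 0 for b ≉ ⊥, contraposed so as not to depend on excluded middle.
  StrictlyPositive : Set ℓ
  StrictlyPositive = ∀ b → μ b ≤ʳ 0ʳ → b ≈ ⊥

  record IsPartitionOfUnity {n} (p : Fin n → Carrier) : Set ℓ where
    field
      disjoint : ∀ i j → i ≢ j → p i ∧ p j ≈ ⊥
      covering : foldr _∨_ ⊥ p ≈ ⊤

  NonAtomic : Set (suc 0ℓ ⊔ ℓ)
  NonAtomic = ∀ ε → 0ʳ <ʳ ε → ∃ λ n → ∃ λ (p : Fin n → Carrier) →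
    IsPartitionOfUnity p × (∀ i → μ (p i) ≤ʳ ε)

  -- ur(μ | b) = κ
  HasUrBelow : Carrier → Setoid ℓ ℓ → Set (suc (suc 0ℓ ⊔ ℓ))
  HasUrBelow b = HasUr (B ↾ b) (μ ∘ proj₁)

  -- ur(μ | b) = ur(μ | a): both values exist and are one and the same κ.
  IsUniform : Carrier → Set (suc (suc 0ℓ ⊔ ℓ))
  IsUniform a = ∀ b → b ≉ ⊥ → b ≤ a → ∃ λ κ → HasUrBelow b κ × HasUrBelow a κ

  UniformlyRegular : Setoid ℓ ℓ → Set (suc (suc 0ℓ ⊔ ℓ))
  UniformlyRegular κ = IsUniform ⊤ × HasUr B μ κ

-- Let F be a uniformly dense family of size κ, and let A be the subalgebra it
-- generates, presented as the quotient of Free(κ) by the kernel of the map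
-- sending the generators onto F.  Given b, choose aₙ ∈ F with aₙ ≤ b and
-- μ(b ∖ aₙ) < 1/(n+1).  Since μ is strictly positive, b is the supremum of the
-- aₙ; in particular A is dense in B, so B embeds into the completion of A by
-- b ↦ {a ∈ A : a ≤ b}.  This map preserves the suprema b = ⋁ aₙ, so its values
-- lie in the σ-completion of A.
module Submission where

open import Defs
open import Algebra.Lattice.Bundles using (BooleanAlgebra)
import Algebra.Lattice.Properties.BooleanAlgebra as BooleanAlgebraProperties
open import Algebra.Lattice.Structures.Biased using (isBooleanAlgebraʳ)
open import Data.Integer.Base using (+_; -[1+_]; +≤+)
import Data.Integer.Properties as ℤ
open import Data.Nat.Base using (ℕ)
import Data.Nat.Base as ℕ
open import Data.Nat.Coprimality using (1-coprimeTo)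
open import Data.Product.Base using (Σ-syntax; ∃; ∃-syntax; _×_; _,_; proj₁; proj₂)
open import Data.Rational.Base using (ℚ; mkℚ; 0ℚ; *≤*) renaming (_<_ to _<ℚ_; _≤_ to _≤ℚ_; _+_ to _+ℚ_; _-_ to _-ℚ_)
import Data.Rational.Base as ℚ
import Data.Rational.Properties as ℚ
open import Data.Sum.Base using (inj₁; inj₂; [_,_])
open import Data.Unit.Base using () renaming (⊤ to Unit)
open import Function.Base using (id; _∘_)
open import Function.Bundles using (Inverse)
open import Level using (Lift; suc; _⊔_)
open import Relation.Binary.Bundles using (Setoid; Poset)
import Relation.Binary.Lattice as OrderTheoretic
import Relation.Binary.Lattice.Properties.DistributiveLattice as DistributiveLatticeProperties
import Relation.Binary.Lattice.Properties.Lattice as LatticeProperties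
import Relation.Binary.PropositionalEquality as ≡
open import Relation.Nullary.Decidable using (yes; no)
open import Relation.Nullary.Negation using (contradiction)
open import Relation.Unary using (Pred; _∈_; _⊆_; _∪_; _∩_)

open ℝ

-- Order and disjointness in a Boolean algebra.

module Disjointness {c ℓ} (A : BooleanAlgebra c ℓ) where
  open BooleanAlgebra A renaming (¬_ to ∁)
  open BooleanAlgebraProperties A
  open Order A
  open Poset poset public using ()
    renaming (refl to ≤-refl; trans to ≤-trans; reflexive to ≤-reflexive; antisym to ≤-antisym)
  open OrderTheoretic.Lattice ∨-∧-orderTheoreticLattice public
    using (x≤x∨y; y≤x∨y; ∨-least; x∧y≤x; x∧y≤y; ∧-greatest)

  infix 4 _⟂_

  _⟂_ : Carrier → Carrier → Set ℓ
  x ⟂ y = x ∧ y ≈ ⊥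

  ⊥-minimum : ∀ x → ⊥ ≤ x
  ⊥-minimum x = sym (∧-zeroˡ x)

  ⊤-maximum : ∀ x → x ≤ ⊤
  ⊤-maximum x = sym (∧-identityʳ x)

  ≤⊥⇒≈⊥ : ∀ {x} → x ≤ ⊥ → x ≈ ⊥
  ≤⊥⇒≈⊥ x≤⊥ = ≤-antisym x≤⊥ (⊥-minimum _)

  ∧-mono : ∀ {x y u v} → x ≤ y → u ≤ v → x ∧ u ≤ y ∧ v
  ∧-mono x≤y u≤v = ∧-greatest (≤-trans (x∧y≤x _ _) x≤y) (≤-trans (x∧y≤y _ _) u≤v)

  ⟂-sym : ∀ {x y} → x ⟂ y → y ⟂ x
  ⟂-sym x⟂y = trans (∧-comm _ _) x⟂y

  ⟂-mono : ∀ {x y u v} → x ≤ y → u ≤ v → y ⟂ v → x ⟂ u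
  ⟂-mono x≤y u≤v y⟂v = ≤⊥⇒≈⊥ (≤-trans (∧-mono x≤y u≤v) (≤-reflexive y⟂v))

  ≤∧⟂⇒≈⊥ : ∀ {x y} → x ≤ y → x ⟂ y → x ≈ ⊥
  ≤∧⟂⇒≈⊥ x≤y x⟂y = trans x≤y x⟂y

  self-⟂⇒≈⊥ : ∀ {x} → x ⟂ x → x ≈ ⊥
  self-⟂⇒≈⊥ = ≤∧⟂⇒≈⊥ ≤-refl

  ⟂-∁ : ∀ {x y} → x ≤ ∁ y → x ⟂ y
  ⟂-∁ x≤∁y = ⟂-mono x≤∁y ≤-refl (∧-complementˡ _)

  ⟂⇒≤∁ : ∀ {x y} → x ⟂ y → x ≤ ∁ y
  ⟂⇒≤∁ {x} {y} x⟂y = sym (trans (sym (∨-identityˡ _)) (trans (∨-congʳ (sym x⟂y))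
    (trans (sym (∧-distribˡ-∨ x y (∁ y))) (trans (∧-congˡ (∨-complementʳ y)) (∧-identityʳ x)))))

  ∖≈⊥⇒≤ : ∀ {x y} → x ∖ y ≈ ⊥ → x ≤ y
  ∖≈⊥⇒≤ x∖y≈⊥ = ≤-trans (⟂⇒≤∁ x∖y≈⊥) (≤-reflexive (¬-involutive _))

  ⟂-shift : ∀ {x y z} → x ⟂ y ∧ z → y ∧ x ⟂ z
  ⟂-shift {x} {y} {z} x⟂y∧z =
    trans (∧-congʳ (∧-comm y x)) (trans (∧-assoc x y z) x⟂y∧z)

  ⟂-absorb : ∀ {x y} → x ⟂ x ∧ y → x ⟂ y
  ⟂-absorb x⟂x∧y = self-⟂⇒≈⊥ (⟂-mono (x∧y≤x _ _) ≤-refl x⟂x∧y)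

  ⟂-∨ : ∀ {x y z} → x ⟂ y → x ⟂ z → x ⟂ y ∨ z
  ⟂-∨ {x} {y} {z} x⟂y x⟂z =
    trans (∧-distribˡ-∨ x y z) (trans (∨-cong x⟂y x⟂z) (∨-identityˡ ⊥))

  ∁-antitone : ∀ {x y} → x ≤ y → ∁ y ≤ ∁ x
  ∁-antitone x≤y = ⟂⇒≤∁ (⟂-mono ≤-refl x≤y (∧-complementˡ _))

  ∨-∖ : ∀ {x y} → x ≤ y → x ∨ (y ∖ x) ≈ y
  ∨-∖ {x} {y} x≤y = ≤-antisym (∨-least x≤y (x∧y≤x _ _))
    (≤-trans (∧-greatest (y≤x∨y x y) (≤-trans (⊤-maximum y) (≤-reflexive (sym (∨-complementʳ x)))))
      (≤-reflexive (sym (∨-distribˡ-∧ x y (∁ x)))))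

  supremum-cong : ∀ {i} {I : Set i} {f g : I → Carrier} {s} →
                  (∀ i → f i ≈ g i) → IsSupremum f s → IsSupremum g s
  supremum-cong f≈g isSup = record
    { upper = λ i → ≤-trans (≤-reflexive (sym (f≈g i))) (upper i)
    ; least = λ u g≤u → least u (λ i → ≤-trans (≤-reflexive (f≈g i)) (g≤u i))
    }
    where open IsSupremum isSup

-- The completion by regular sets.

-- Regular sets stand for the regular open subsets of the Stone space: taking
-- double polars instead of double complements makes them a Boolean algebra
-- without excluded middle.
module RegularSets {ℓ} (A : BooleanAlgebra ℓ ℓ) where
  open BooleanAlgebra A using (Carrier; _≈_; trans; ∧-assoc) renaming (_∧_ to _∧ᴬ_; ⊥ to ⊥ᴬ)
  open BooleanAlgebraProperties A using (∧-identityˡ; ∧-zeroˡ; ∧-zeroʳ)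
  open Order A
  open Disjointness A

  -- The annihilator of `P`. It forms an antitone Galois connection with itself, so double polars
  -- are closures.
  polar : Pred Carrier ℓ → Pred Carrier ℓ
  polar P a = ∀ {x} → x ∈ P → a ⟂ x

  polar-antitone : ∀ {P Q} → P ⊆ Q → polar Q ⊆ polar P
  polar-antitone P⊆Q a⟂Q x∈P = a⟂Q (P⊆Q x∈P)

  ⊆polar² : ∀ {P} → P ⊆ polar (polar P)
  ⊆polar² x∈P a⟂P = ⟂-sym (a⟂P x∈P)

  record RegularSet : Set (suc ℓ) where
    field
      Member : Pred Carrier ℓ
      stable : polar (polar Member) ⊆ Member

  open RegularSet public

  downward-closed : ∀ U {a b} → a ≤ b → b ∈ Member U → a ∈ Member U
  downward-closed U a≤b b∈U = stable U λ x⟂U → ⟂-mono a≤b ≤-refl (⟂-sym (x⟂U b∈U))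

  polarSet : Pred Carrier ℓ → RegularSet
  polarSet P = record
    { Member = polar P
    -- A triple polar lies in the single one: apply antitonicity to the inclusion of `P` in its
    -- double polar.
    ; stable = polar-antitone ⊆polar²
    }

  closure : Pred Carrier ℓ → RegularSet
  closure P = polarSet (polar P)

  closure-least : ∀ {P} U → P ⊆ Member U → Member (closure P) ⊆ Member U
  closure-least U P⊆U a∈P⁺ = stable U (polar-antitone (polar-antitone P⊆U) a∈P⁺)

  infix  4 _⊑_
  infixr 7 _∧_
  infixr 6 _∨_

  _⊑_ : RegularSet → RegularSet → Set ℓ
  U ⊑ V = Member U ⊆ Member V

  -- Double polars are monotone, so an intersection of stable sets is stable; a union need not be,
  -- so the join takes its closure.
  _∧_ _∨_ : RegularSet → RegularSet → RegularSet
  U ∧ V = record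
    { Member = Member U ∩ Member V
    ; stable = λ a∈ → stable U (polar-antitone (polar-antitone proj₁) a∈)
                    , stable V (polar-antitone (polar-antitone proj₂) a∈)
    }
  U ∨ V = closure (Member U ∪ Member V)

  infix 8 ∁_

  ∁_ : RegularSet → RegularSet
  ∁ U = polarSet (Member U)

  ⊤ ⊥ : RegularSet
  ⊤ = record { Member = λ _ → Lift ℓ Unit ; stable = _ }
  ⊥ = record
    { Member = λ a → a ≈ ⊥ᴬ
    ; stable = λ {a} a∈ → self-⟂⇒≈⊥ (a∈ λ x≈⊥ → ⟂-mono (⊤-maximum a) (≤-reflexive x≈⊥) (∧-zeroʳ _))
    }

  ∧-member : ∀ U V {u v} → u ∈ Member U → v ∈ Member V → u ∧ᴬ v ∈ Member (U ∧ V)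
  ∧-member U V u∈U v∈V = downward-closed U (x∧y≤x _ _) u∈U , downward-closed V (x∧y≤y _ _) v∈V

  distributiveLattice : OrderTheoretic.DistributiveLattice (suc ℓ) ℓ ℓ
  distributiveLattice = record
    { Carrier = RegularSet
    ; _≈_ = λ U V → U ⊑ V × V ⊑ U
    ; _≤_ = _⊑_
    ; _∨_ = _∨_
    ; _∧_ = _∧_
    ; isDistributiveLattice = record
      { isLattice = record
        { isPartialOrder = record
          { isPreorder = record
            { isEquivalence = record
              { refl  = id , id
              ; sym   = λ (U⊑V , V⊑U) → V⊑U , U⊑V
              ; trans = λ (U⊑V , V⊑U) (V⊑W , W⊑V) → V⊑W ∘ U⊑V , V⊑U ∘ W⊑V
              }
            ; reflexive = proj₁
            ; trans     = λ U⊑V V⊑W → V⊑W ∘ U⊑V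
            }
          ; antisym = _,_
          }
        ; supremum = λ U V → ⊆polar² ∘ inj₁ , ⊆polar² ∘ inj₂ ,
            λ W U⊑W V⊑W → closure-least W [ U⊑W , V⊑W ]
        ; infimum = λ U V → proj₁ , proj₂ , λ W W⊑U W⊑V w∈W → W⊑U w∈W , W⊑V w∈W
        }
      ; ∧-distribˡ-∨ = λ U V W → ∧-distribˡ-∨-⊑ U V W ,
          closure-least (U ∧ (V ∨ W))
            [ (λ (a∈U , a∈V) → a∈U , ⊆polar² (inj₁ a∈V))
            , (λ (a∈U , a∈W) → a∈U , ⊆polar² (inj₂ a∈W)) ]
      }
    }
    where
    -- Let `x` be disjoint from `U ∧ V` and `U ∧ W`. Meets of `a` with members of `V` or `W` stay in
    -- `U`, so `a ∧ᴬ x` is disjoint from `V` and `W`. Hence `a`, in the double polar of their union,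
    -- is disjoint from `a ∧ᴬ x`, that is, from `x`.
    ∧-distribˡ-∨-⊑ : ∀ U V W → U ∧ (V ∨ W) ⊑ (U ∧ V) ∨ (U ∧ W)
    ∧-distribˡ-∨-⊑ U V W (a∈U , a∈V∨W) x⟂ = ⟂-absorb (a∈V∨W λ
      { (inj₁ v∈V) → ⟂-shift (x⟂ (inj₁ (∧-member U V a∈U v∈V)))
      ; (inj₂ w∈W) → ⟂-shift (x⟂ (inj₂ (∧-member U W a∈U w∈W))) })

  algebra : BooleanAlgebra (suc ℓ) ℓ
  algebra = record
    { Carrier = RegularSet
    ; _≈_ = λ U V → U ⊑ V × V ⊑ U
    ; _∨_ = _∨_
    ; _∧_ = _∧_
    ; ¬_  = ∁_
    ; ⊤   = ⊤
    ; ⊥   = ⊥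
    ; isBooleanAlgebra = isBooleanAlgebraʳ (record
      { isDistributiveLattice = record
        { isLattice   = LatticeProperties.isAlgLattice (OrderTheoretic.DistributiveLattice.lattice distributiveLattice)
        ; ∨-distrib-∧ = DistributiveLatticeProperties.∨-distrib-∧ distributiveLattice
        ; ∧-distrib-∨ = DistributiveLatticeProperties.∧-distrib-∨ distributiveLattice
        }
      -- What is disjoint from `U` lies in `∁ U`; if disjoint from that too, it is disjoint from
      -- itself. So the union has only `⊥ᴬ` in its polar.
      ; ∨-complementʳ = λ U → _ ,
          λ _ x⟂ → ⟂-mono (⊤-maximum _) ≤-refl (trans (∧-identityˡ _)
            (self-⟂⇒≈⊥ (x⟂ (inj₂ (λ u∈U → x⟂ (inj₁ u∈U))))))
      ; ∧-complementʳ = λ U → (λ (a∈U , a⟂U) → self-⟂⇒≈⊥ (a⟂U a∈U)) ,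
          λ a≈⊥ → stable (U ∧ ∁ U) (λ _ → ⟂-mono (≤-reflexive a≈⊥) ≤-refl (∧-zeroˡ _))
      ; ¬-cong = λ (U⊑V , V⊑U) → polar-antitone V⊑U , polar-antitone U⊑V
      })
    }

  ⊑⇒≤ : ∀ U V → U ⊑ V → Order._≤_ algebra U V
  ⊑⇒≤ _ _ U⊑V = (λ u∈U → u∈U , U⊑V u∈U) , proj₁

  ≤⇒⊑ : ∀ U V → Order._≤_ algebra U V → U ⊑ V
  ≤⇒⊑ _ _ (U⊑U∧V , _) = proj₂ ∘ U⊑U∧V

  -- With `I` in `Set ℓ`, the union of the family is again a predicate at level `ℓ`, and its closure
  -- is the supremum.
  complete : {I : Set ℓ} (f : I → RegularSet) → ∃ λ s → Order.IsSupremum algebra f s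
  complete f = sup , record
    { upper = λ i → ⊑⇒≤ (f i) sup (λ a∈fi → ⊆polar² (i , a∈fi))
    ; least = λ U f≤U → ⊑⇒≤ sup U (closure-least U (λ (i , a∈fi) → ≤⇒⊑ (f i) U (f≤U i) a∈fi))
    }
    where
    sup : RegularSet
    sup = closure (λ a → ∃[ i ] a ∈ Member (f i))

-- Embedding an algebra into the regular sets of a dense subalgebra.

module DenseEmbedding {a ℓ} {A : BooleanAlgebra ℓ ℓ} {B : BooleanAlgebra a ℓ}
  {h : BooleanAlgebra.Carrier A → BooleanAlgebra.Carrier B} (h-isEmbedding : IsEmbedding A B h)
  (dense : ∀ b → (∀ a → Order._≤_ B (h a) b → BooleanAlgebra._≈_ A a (BooleanAlgebra.⊥ A)) →
           BooleanAlgebra._≈_ B b (BooleanAlgebra.⊥ B))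
  where
  private
    module A where
      open BooleanAlgebra A public
      open Order A public
      open Disjointness A public
    module h = IsEmbedding h-isEmbedding
    module R = RegularSets A
  open BooleanAlgebra B renaming (¬_ to ∁)
  open Order B
  open Disjointness B
  open R using (RegularSet; _⊑_)

  h-mono : ∀ {x y} → x A.≤ y → h x ≤ h y
  h-mono x≤y = trans (h.⟦⟧-cong x≤y) (h.∧-homo _ _)

  h-reflects-≤ : ∀ {x y} → h x ≤ h y → x A.≤ y
  h-reflects-≤ hx≤hy = h.injective (trans hx≤hy (sym (h.∧-homo _ _)))

  h-preserves-⟂ : ∀ {x y} → x A.⟂ y → h x ⟂ h y
  h-preserves-⟂ x⟂y = trans (sym (h.∧-homo _ _)) (trans (h.⟦⟧-cong x⟂y) h.⊥-homo)

  h-reflects-⟂ : ∀ {x y} → h x ⟂ h y → x A.⟂ y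
  h-reflects-⟂ hx⟂hy = h.injective (trans (h.∧-homo _ _) (trans hx⟂hy (sym h.⊥-homo)))

  ≤∧⟂⇒≈⊥ᴬ : ∀ {x y} → h x ≤ h y → y A.⟂ x → x A.≈ A.⊥
  ≤∧⟂⇒≈⊥ᴬ hx≤hy y⟂x =
    h.injective (trans (≤∧⟂⇒≈⊥ hx≤hy (⟂-sym (h-preserves-⟂ y⟂x))) (sym h.⊥-homo))

  -- By density it suffices to test the `a` with `h a` under both `h x` and `b`: such an `a` is
  -- under `x` and disjoint from it.
  polar-below⇒⟂ : ∀ {b x} → x ∈ R.polar (λ a → h a ≤ b) → h x ⟂ b
  polar-below⇒⟂ x⟂b = dense _ λ a ha≤hx∧b →
    ≤∧⟂⇒≈⊥ᴬ (≤-trans ha≤hx∧b (x∧y≤x _ _)) (x⟂b (≤-trans ha≤hx∧b (x∧y≤y _ _)))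

  -- For stability, let `a` be in the double polar and `h x` under `h a` but disjoint from `b`. Then
  -- `x` is in the polar, so it is disjoint from `a` as well as under it. By density nothing of
  -- `h a` is left outside `b`.
  below : Carrier → RegularSet
  below b = record
    { Member = λ a → h a ≤ b
    ; stable = λ {a} a∈ → ∖≈⊥⇒≤ (dense (h a ∖ b) λ x hx≤ha∖b →
        ≤∧⟂⇒≈⊥ᴬ (≤-trans hx≤ha∖b (x∧y≤x _ _)) (a∈ λ hy≤b →
          h-reflects-⟂ (⟂-mono ≤-refl hy≤b (⟂-∁ (≤-trans hx≤ha∖b (x∧y≤y _ _))))))
    }

  below-mono : ∀ {b c} → b ≤ c → below b ⊑ below c
  below-mono b≤c ha≤b = ≤-trans ha≤b b≤c

  -- An element of `A` under the part of `b` outside `c` is by inclusion also under `c`, so it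
  -- vanishes, and density applies.
  below-reflects : ∀ {b c} → below b ⊑ below c → b ≤ c
  below-reflects b⊑c = ∖≈⊥⇒≤ (dense _ λ a ha≤b∖c → h.injective (trans
    (≤∧⟂⇒≈⊥ ≤-refl (⟂-mono (b⊑c (≤-trans ha≤b∖c (x∧y≤x _ _))) (≤-trans ha≤b∖c (x∧y≤y _ _)) (∧-complementʳ _)))
    (sym h.⊥-homo)))

  isEmbedding : IsEmbedding B R.algebra below
  isEmbedding = record
    { isLatticeMonomorphism = record
      { isLatticeHomomorphism = record
        { isRelHomomorphism = record
          { cong = λ b≈c → below-mono (≤-reflexive b≈c) , below-mono (≤-reflexive (sym b≈c)) }
        ; ∧-homo = λ b c →
            (λ ha≤b∧c → ≤-trans ha≤b∧c (x∧y≤x b c) , ≤-trans ha≤b∧c (x∧y≤y b c)) ,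
            λ (ha≤b , ha≤c) → ∧-greatest ha≤b ha≤c
        -- An `x` in the polar of the union has `h x` disjoint from `b` and from `c`, hence from
        -- everything under `b ∨ c`.
        ; ∨-homo = λ b c →
            (λ ha≤b∨c x⟂ → h-reflects-⟂ (⟂-mono ha≤b∨c ≤-refl
              (⟂-sym (⟂-∨ (polar-below⇒⟂ (x⟂ ∘ inj₁)) (polar-below⇒⟂ (x⟂ ∘ inj₂)))))) ,
            R.closure-least (below (b ∨ c)) [ below-mono (x≤x∨y b c) , below-mono (y≤x∨y b c) ]
        }
      ; injective = λ (b⊑c , c⊑b) → ≤-antisym (below-reflects b⊑c) (below-reflects c⊑b)
      }
    ; preservesComplements = record
      { ⊤-homo = _ , λ _ → ⊤-maximum _
      ; ⊥-homo = (λ ha≤⊥ → h.injective (trans (≤⊥⇒≈⊥ ha≤⊥) (sym h.⊥-homo))) ,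
          λ a≈⊥ → ≤-reflexive (trans (h.⟦⟧-cong a≈⊥) h.⊥-homo)
      ; ¬-homo = λ b →
          (λ ha≤∁b hx≤b → h-reflects-⟂ (⟂-mono ≤-refl hx≤b (⟂-∁ ha≤∁b))) ,
          λ a⟂b → ⟂⇒≤∁ (polar-below⇒⟂ a⟂b)
      }
    }

  -- If `x` is in the polar of an upper bound `U`, then `∁ (h x)` bounds all `h (s i)` and therefore
  -- `b`. So every `a` with `h a ≤ b` is disjoint from `x`, which puts it in `U` by stability.
  below-supremum : ∀ {i} {I : Set i} (s : I → A.Carrier) {b} → IsSupremum (h ∘ s) b →
                   Order.IsSupremum R.algebra (below ∘ h ∘ s) (below b)
  below-supremum s {b} isSup = record
    { upper = λ i → R.⊑⇒≤ (below (h (s i))) (below b) (below-mono (upper i))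
    ; least = λ U s≤U → R.⊑⇒≤ (below b) U λ {a} ha≤b → R.stable U λ {x} x⟂U →
        h-reflects-⟂ (⟂-mono ha≤b ≤-refl (⟂-∁ (least (∁ (h x)) λ i →
          ⟂⇒≤∁ (h-preserves-⟂ (A.⟂-sym (x⟂U (R.≤⇒⊑ (below (h (s i))) U (s≤U i) ≤-refl)))))))
    }
    where open IsSupremum isSup

id-isEmbedding : ∀ {c ℓ} (A : BooleanAlgebra c ℓ) → IsEmbedding A A id
id-isEmbedding A = record
  { isLatticeMonomorphism = record
    { isLatticeHomomorphism = record
      { isRelHomomorphism = record { cong = id }
      ; ∧-homo = λ _ _ → refl
      ; ∨-homo = λ _ _ → refl
      }
    ; injective = id
    }
  ; preservesComplements = record { ⊤-homo = refl ; ⊥-homo = refl ; ¬-homo = λ _ → refl }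
  }
  where open BooleanAlgebra A using (refl)

completion : ∀ {ℓ} (A : BooleanAlgebra ℓ ℓ) → Completion A
completion A = record
  { algebra     = RegularSets.algebra A
  ; complete    = RegularSets.complete A
  ; embed       = below
  ; isEmbedding = isEmbedding
  -- A member `a` of `U` has `below a` inside `U` by downward closure, so the hypothesis makes it
  -- `⊥`.
  ; dense       = λ U ↓a⊆U⇒a≈⊥ →
      (λ {a} a∈U → ↓a⊆U⇒a≈⊥ a (⊑⇒≤ (below a) U λ x≤a → downward-closed U x≤a a∈U)) ,
      λ a≈⊥ → downward-closed U (≤-reflexive a≈⊥) (stable U λ _ → ∧-zeroˡ _)
  }
  where
  open RegularSets A using (⊑⇒≤; downward-closed; stable)
  open BooleanAlgebraProperties A using (∧-zeroˡ)
  open Disjointness A using (≤-refl; ≤-reflexive)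
  -- With the identity as `h`, `below` yields principal ideals, and density is tested on `b` itself.
  open DenseEmbedding (id-isEmbedding A) (λ b a≤b⇒a≈⊥ → a≤b⇒a≈⊥ b ≤-refl)

-- Images of embeddings.

module _ {a b ℓ₁ ℓ₂} {A : BooleanAlgebra a ℓ₁} {B : BooleanAlgebra b ℓ₂}
  {f : BooleanAlgebra.Carrier A → BooleanAlgebra.Carrier B} (isEmbedding : IsEmbedding A B f) where
  private module A = BooleanAlgebra A
  open BooleanAlgebra B using (_≈_; refl; sym; trans; ∨-cong; ∧-cong; ¬-cong)
  open IsEmbedding isEmbedding

  image : Subalgebra B (a ⊔ ℓ₂)
  image = record
    { Member   = λ y → ∃[ x ] f x ≈ y
    ; ∨-closed = λ (x , fx≈u) (y , fy≈v) → x A.∨ y , trans (∨-homo x y) (∨-cong fx≈u fy≈v)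
    ; ∧-closed = λ (x , fx≈u) (y , fy≈v) → x A.∧ y , trans (∧-homo x y) (∧-cong fx≈u fy≈v)
    ; ¬-closed = λ (x , fx≈u) → A.¬ x , trans (¬-homo x) (¬-cong fx≈u)
    ; ⊤-closed = A.⊤ , ⊤-homo
    ; ⊥-closed = A.⊥ , ⊥-homo
    ; ≈-closed = λ u≈v (x , fx≈u) → x , trans fx≈u u≈v
    }

  image-isomorphic : Isomorphism A (subalgebra B image)
  image-isomorphic = record
    { to = λ x → f x , x , refl
    ; isLatticeIsomorphism = record
      { isLatticeMonomorphism = record
        { isLatticeHomomorphism = record
          { isRelHomomorphism = record { cong = ⟦⟧-cong }
          ; ∧-homo = ∧-homo
          ; ∨-homo = ∨-homo
          }
        ; injective = injective
        }
      ; surjective = λ (y , x , fx≈y) → x , λ z≈x → trans (⟦⟧-cong z≈x) fx≈y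
      }
    ; preservesComplements = record { ⊤-homo = ⊤-homo ; ⊥-homo = ⊥-homo ; ¬-homo = ¬-homo }
    }

-- Generated subalgebras as quotients of free algebras.

module _ {ℓ} (κ : Setoid ℓ ℓ) (B : BooleanAlgebra ℓ ℓ)
  (g : Setoid.Carrier κ → BooleanAlgebra.Carrier B)
  (g-cong : ∀ {i j} → Setoid._≈_ κ i j → BooleanAlgebra._≈_ B (g i) (g j)) where
  private
    module B = BooleanAlgebra B
    module F = FreeBooleanAlgebra κ
  open FreeBooleanAlgebra κ using (Term; gen; _∨_; _∧_; ∁_; ⊤; ⊥)

  ⟦_⟧ : Term → B.Carrier
  ⟦ gen i ⟧ = g i
  ⟦ s ∨ t ⟧ = ⟦ s ⟧ B.∨ ⟦ t ⟧
  ⟦ s ∧ t ⟧ = ⟦ s ⟧ B.∧ ⟦ t ⟧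
  ⟦ ∁ t ⟧   = B.¬ ⟦ t ⟧
  ⟦ ⊤ ⟧     = B.⊤
  ⟦ ⊥ ⟧     = B.⊥

  ⟦⟧-sound : ∀ {s t} → s F.≈ t → ⟦ s ⟧ B.≈ ⟦ t ⟧
  ⟦⟧-sound F.refl = B.refl
  ⟦⟧-sound (F.sym p) = B.sym (⟦⟧-sound p)
  ⟦⟧-sound (F.trans p q) = B.trans (⟦⟧-sound p) (⟦⟧-sound q)
  ⟦⟧-sound (F.gen-cong p) = g-cong p
  ⟦⟧-sound (F.∨-cong p q) = B.∨-cong (⟦⟧-sound p) (⟦⟧-sound q)
  ⟦⟧-sound (F.∧-cong p q) = B.∧-cong (⟦⟧-sound p) (⟦⟧-sound q)
  ⟦⟧-sound (F.∁-cong p) = B.¬-cong (⟦⟧-sound p)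
  ⟦⟧-sound (F.∨-comm _ _) = B.∨-comm _ _
  ⟦⟧-sound (F.∨-assoc _ _ _) = B.∨-assoc _ _ _
  ⟦⟧-sound (F.∧-comm _ _) = B.∧-comm _ _
  ⟦⟧-sound (F.∧-assoc _ _ _) = B.∧-assoc _ _ _
  ⟦⟧-sound (F.∨-absorbs-∧ _ _) = B.∨-absorbs-∧ _ _
  ⟦⟧-sound (F.∧-absorbs-∨ _ _) = B.∧-absorbs-∨ _ _
  ⟦⟧-sound (F.∨-distribʳ-∧ _ _ _) = B.∨-distribʳ-∧ _ _ _
  ⟦⟧-sound (F.∨-complementʳ _) = B.∨-complementʳ _
  ⟦⟧-sound (F.∧-complementʳ _) = B.∧-complementʳ _

  -- Equality of values in `B` makes the quotient a copy of the subalgebra generated by the range of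
  -- `g`, with `⟦_⟧` injective by definition.
  kernel : Congruence (Free κ) ℓ
  kernel = record
    { _∼_             = λ s t → ⟦ s ⟧ B.≈ ⟦ t ⟧
    ; isEquivalence-∼ = record { refl = B.refl ; sym = B.sym ; trans = B.trans }
    ; ≈⇒∼             = ⟦⟧-sound
    ; ∨-cong-∼        = B.∨-cong
    ; ∧-cong-∼        = B.∧-cong
    ; ¬-cong-∼        = B.¬-cong
    }

  ⟦⟧-isEmbedding : IsEmbedding (quotient (Free κ) kernel) B ⟦_⟧
  ⟦⟧-isEmbedding = record
    { isLatticeMonomorphism = record
      { isLatticeHomomorphism = record
        { isRelHomomorphism = record { cong = id }
        ; ∧-homo = λ _ _ → B.refl
        ; ∨-homo = λ _ _ → B.refl
        }
      ; injective = id
      }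
    ; preservesComplements = record { ⊤-homo = B.refl ; ⊥-homo = B.refl ; ¬-homo = λ _ → B.refl }
    }

-- Small positive rationals and cuts.

1/suc : ℕ → ℚ
1/suc n = mkℚ (+ 1) n (1-coprimeTo (ℕ.suc n))

1/suc-positive : ∀ n → 0ℚ <ℚ 1/suc n
1/suc-positive n = ℚ.positive⁻¹ (1/suc n)

-- A positive fraction has numerator at least 1, so the unit fraction with the same denominator
-- works.
archimedean : ∀ q → 0ℚ <ℚ q → ∃[ n ] 1/suc n ≤ℚ q
archimedean q@(mkℚ (+ ℕ.suc m) n _) _ = n , *≤* (ℤ.*-monoʳ-≤-nonNeg (+ ℕ.suc n) (+≤+ (ℕ.s≤s (ℕ.z≤n {m}))))
archimedean (mkℚ (+ 0) _ _) 0<q with () ← ℚ.positive 0<q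
archimedean (mkℚ -[1+ _ ] _ _) 0<q with () ← ℚ.positive 0<q

fromℚ-positive : ∀ {q} → 0ℚ <ℚ q → 0ʳ <ʳ fromℚ q
fromℚ-positive 0<q = 0ℚ , 0<q , ℚ.<-irrefl ≡.refl

-- A nonnegative `p` in the open cut would give a positive `q` in it, above some `1/suc n`; but `x`
-- omits a rational below `1/suc n`.
<1/suc⇒≤0 : ∀ x → (∀ n → x <ʳ fromℚ (1/suc n)) → x ≤ʳ 0ʳ
<1/suc⇒≤0 x x<1/suc {p} p∈x with p ℚ.<? 0ℚ
... | yes p<0 = p<0
... | no p≮0 =
  let q , p<q , q∈x       = open-cut x p∈x
      n , 1/suc-n≤q       = archimedean q (ℚ.≤-<-trans (ℚ.≮⇒≥ p≮0) p<q)
      r , r<1/suc-n , r∉x = x<1/suc n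
  in contradiction (downward x (ℚ.<-≤-trans r<1/suc-n 1/suc-n≤q) q∈x) r∉x

≤-<-transʳ : ∀ x y z → x ≤ʳ y → y <ʳ z → x <ʳ z
≤-<-transʳ _ _ _ x≤y (q , q∈z , q∉y) = q , q∈z , q∉y ∘ x≤y

-- Openness of `x` gives `q` above `p`; then `p` is `q` plus a negative rational, which lies in `y`.
x≤x+y : ∀ x y → 0ʳ ≤ʳ y → x ≤ʳ x +ʳ y
x≤x+y x y 0≤y {p} p∈x =
  let q , p<q , q∈x = open-cut x p∈x in
  q , p -ℚ q , q∈x ,
  0≤y (≡.subst (p -ℚ q <ℚ_) (ℚ.+-inverseʳ q) (ℚ.+-monoˡ-< (ℚ.- q) p<q)) ,
  ≡.sym (≡.trans (ℚ.+-comm q _) (≡.trans (ℚ.+-assoc p _ q)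
    (≡.trans (≡.cong (p +ℚ_) (ℚ.+-inverseˡ q)) (ℚ.+-identityʳ p))))

-- Countable approximation in measure.

module _ {ℓ} {B : BooleanAlgebra ℓ ℓ} (M : Measure B) where
  open BooleanAlgebra B
  open Order B
  open Disjointness B
  open Measure M

  μ-mono : ∀ {x y} → x ≤ y → μ x ≤ʳ μ y
  μ-mono {x} {y} x≤y p∈μx =
    proj₁ (μ-cong (∨-∖ x≤y)) (proj₂ (additive x (y ∖ x) (⟂-sym (⟂-∁ (x∧y≤y y _))))
      (x≤x+y (μ x) (μ (y ∖ x)) (nonNegative _) p∈μx))

  -- The part of `b` outside an upper bound `u` lies in the part outside each `s n`, so its measure
  -- is below every `1/suc n`; strict positivity makes it `⊥`.
  uniformlyDense⇒supremum : StrictlyPositive M → ∀ {F : Pred Carrier ℓ} → IsUniformlyDense B μ F →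
    ∀ b → ∃ λ (s : ℕ → Carrier) → (∀ n → s n ∈ F) × IsSupremum s b
  uniformlyDense⇒supremum strictlyPositive {F} F-dense b =
    proj₁ ∘ approx , proj₁ ∘ proj₂ ∘ approx , record
      { upper = λ n → proj₁ (proj₂ (proj₂ (approx n)))
      ; least = λ u s≤u → ∖≈⊥⇒≤ (strictlyPositive (b ∖ u) (<1/suc⇒≤0 (μ (b ∖ u)) λ n →
          ≤-<-transʳ (μ (b ∖ u)) (μ (b ∖ proj₁ (approx n))) (fromℚ (1/suc n))
            (μ-mono (∧-mono ≤-refl (∁-antitone (s≤u n)))) (proj₂ (proj₂ (proj₂ (approx n))))))
      }
    where
    approx : ∀ n → ∃ λ a → a ∈ F × a ≤ b × μ (b ∖ a) <ʳ fromℚ (1/suc n)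
    approx n = F-dense b (fromℚ (1/suc n)) (fromℚ-positive (1/suc-positive n))

-- From countable suprema to the σ-completion.

module _ {ℓ} {A B : BooleanAlgebra ℓ ℓ} {h : BooleanAlgebra.Carrier A → BooleanAlgebra.Carrier B}
  (h-isEmbedding : IsEmbedding A B h)
  (approximate : ∀ b → ∃ λ (s : ℕ → BooleanAlgebra.Carrier A) → Order.IsSupremum B (h ∘ s) b) where
  private
    module A = BooleanAlgebra A
  open BooleanAlgebra B
  open Order B
  open Disjointness B
  open IsEmbedding h-isEmbedding using (⟦⟧-cong; ⊥-homo)

  countable-suprema⇒dense : ∀ b → (∀ a → h a ≤ b → a A.≈ A.⊥) → b ≈ ⊥
  countable-suprema⇒dense b a≤b⇒a≈⊥ =
    let s , isSup = approximate b
        open IsSupremum isSup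
    in ≤⊥⇒≈⊥ (least ⊥ λ n → ≤-reflexive (trans (⟦⟧-cong (a≤b⇒a≈⊥ (s n) (upper n))) ⊥-homo))

  open DenseEmbedding h-isEmbedding countable-suprema⇒dense

  below-σGenerated : ∀ b → σGenerated (completion A) (below b)
  below-σGenerated b =
    let s , isSup = approximate b in
    -- The completion embeds `s n` as its principal ideal in `A`; this is `below (h (s n))` because
    -- `h` preserves and reflects the order.
    ⋁-closed (below ∘ h ∘ s) (λ n → ≈-closed (h-mono , h-reflects-≤) (embedded (s n))) (below-supremum s isSup)

  below-isEmbeddingσ : IsEmbedding B (σCompletion (completion A)) (λ b → below b , below-σGenerated b)
  below-isEmbeddingσ = record
    { isLatticeMonomorphism = record
      { isLatticeHomomorphism = record
        { isRelHomomorphism = record { cong = below.⟦⟧-cong }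
        ; ∧-homo = below.∧-homo
        ; ∨-homo = below.∨-homo
        }
      ; injective = below.injective
      }
    ; preservesComplements = record
      { ⊤-homo = below.⊤-homo ; ⊥-homo = below.⊥-homo ; ¬-homo = below.¬-homo }
    }
    where module below = IsEmbedding isEmbedding

  isomorphic-to-σCompletion-subalgebra :
    Σ[ S ∈ Subalgebra (σCompletion (completion A)) ℓ ] Isomorphism B (subalgebra (σCompletion (completion A)) S)
  isomorphic-to-σCompletion-subalgebra = image below-isEmbeddingσ , image-isomorphic below-isEmbeddingσ

-- The theorem on uniformly regular measures.

proposition5p2 : ∀ {ℓ} (κ : Setoid ℓ ℓ) → Infinite κ →
    (B : BooleanAlgebra ℓ ℓ) (μ : Measure B) →
    StrictlyPositive μ → NonAtomic μ → UniformlyRegular μ κ →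
    Σ[ θ ∈ Congruence (Free κ) ℓ ]
    Σ[ C ∈ Completion (quotient (Free κ) θ) ]
    Σ[ S ∈ Subalgebra (σCompletion C) ℓ ]
    Isomorphism B (subalgebra (σCompletion C) S)
proposition5p2 κ _ B μ strictlyPositive _ (_ , hasUr) =
  θ , completion (quotient (Free κ) θ) ,
  isomorphic-to-σCompletion-subalgebra {A = quotient (Free κ) θ} {B} {⟦_⟧ κ B g to-cong}
    (⟦⟧-isEmbedding κ B g to-cong) approximate
  where
  F-dense = proj₁ (proj₂ (HasUr.attained hasUr))
  open Disjointness B using (supremum-cong)
  open Inverse (proj₂ (proj₂ (HasUr.attained hasUr)))
  g = proj₁ ∘ to
  θ = kernel κ B g to-cong

  approximate : ∀ b → ∃ λ s → Order.IsSupremum B (⟦_⟧ κ B g to-cong ∘ s) b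
  approximate b =
    let s , s∈F , isSup = uniformlyDense⇒supremum μ strictlyPositive F-dense b in
    -- As `s n` is in the dense family, the bijection with `κ` names a generator whose value is
    -- `s n`.
    (λ n → FreeBooleanAlgebra.gen (from (s n , s∈F n))) ,
    supremum-cong (λ n → BooleanAlgebra.sym B (strictlyInverseˡ (s n , s∈F n))) isSup
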